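{- Let $k \ge 1$, $n \ge 1$ and $1 \le r \le k$ be integers, and let $\lambda=(\lambda_1,\dots,\lambda_\ell)$ be an integer partition with $\ell$ parts. Then the number of small $(k,r)$-Fuss-Schr\"{o}der paths of length $n$ with type $\lambda$ is $$\binom{n-1}{|\lambda|-1}\binom{nk}{\ell-1}\frac{(\ell-1)!}{m_\lambda} = \frac{1}{nk+1}\binom{n-1}{|\lambda|-1}\binom{nk+1}{\ell}\frac{\ell!}{m_\lambda}.$$ In particular, when $k=1$ this number equals $\binom{n-1}{|\lambda|-1}\binom{n}{\ell-1}\frac{(\ell-1)!}{m_\lambda}=\frac{1}{n+1}\binom{n-1}{|\lambda|-1}\binom{n+1}{\ell}\frac{\ell!}{m_\lambda}$, and when $|\lambda|=n$ it equals $\binom{nk}{\ell-1}\frac{(\ell-1)!}{m_\lambda}=\frac{1}{nk+1}\binom{nk+1}{\ell}\frac{\ell!}{m_\lambda}$.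
   Context: Steps: east $E=(1,0)$, north $N=(0,1)$, diagonal $D=(1,1)$. For positive integers $k$ and $r$ with $1 \le r \le k$, a large $(k,r)$-Fuss-Schr\"{o}der path of length $n$ is a lattice path from $(0,0)$ to $(n,kn)$ using steps $E$, $N$, $D$ such that (C1) the path never passes below the line $y=kx$, and (C2) every diagonal step goes from the line $y=kj+r-1$ to the line $y=kj+r$ for some integer $j$. A small $(k,r)$-Fuss-Schr\"{o}der path is a large $(k,r)$-Fuss-Schr\"{o}der path with no diagonal step touching the line $y=kx$. The type of such a path is the integer partition formed by the lengths of its maximal runs of consecutive east steps. For a partition $\lambda$, $|\lambda|$ is the sum of its parts, $\ell=\ell(\lambda)$ its number of parts, and $m_\lambda = m_1(\lambda)!\,m_2(\lambda)!\,m_3(\lambda)!\cdots$, where $m_i(\lambda)$ is the number of parts of $\lambda$ equal to $i$. -}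

module Defs where

open import Data.Nat using (ℕ; zero; suc; _+_; _*_; _≤_; _≟_)
open import Data.Nat using (_!)
open import Data.List using (List; []; _∷_; _++_; length; filter; map; upTo)
open import Data.Nat.ListAction using (sum; product)
open import Data.List.Relation.Unary.All using (All)
open import Data.List.Relation.Unary.Linked using (Linked)
open import Data.Product using (Σ; _×_; ∃; _,_)
open import Relation.Binary.PropositionalEquality using (_≡_; _≢_)
open import Relation.Nullary using (¬_)

data Step : Set where
  E N D : Step

dx : Step → ℕ
dx E = 1
dx N = 0
dx D = 1

dy : Step → ℕ
dy E = 0
dy N = 1
dy D = 1

xpos : List Step → ℕ
xpos p = sum (map dx p)

ypos : List Step → ℕ
ypos p = sum (map dy p)

-- A large (k,r)-Fuss-Schröder path of length n.
-- (C1) every vertex (x,y) of the path satisfies y ≥ k x (the steps are unit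
--      segments between vertices, so this is "never passes below y = kx");
-- (C2) every diagonal step starts on a line y = k j + r - 1, i.e. goes from
--      y = kj+r-1 to y = kj+r.
record LargeFS (k r n : ℕ) (p : List Step) : Set where
  field
    endX : xpos p ≡ n
    endY : ypos p ≡ k * n
    C1   : ∀ s t → p ≡ s ++ t → k * xpos s ≤ ypos s
    C2   : ∀ s t → p ≡ s ++ (D ∷ t) → ∃ λ j → suc (ypos s) ≡ k * j + r

record SmallFS (k r n : ℕ) (p : List Step) : Set where
  field
    large    : LargeFS k r n p
    noTouch₀ : ∀ s t → p ≡ s ++ (D ∷ t) → ypos s ≢ k * xpos s
    noTouch₁ : ∀ s t → p ≡ s ++ (D ∷ t) → suc (ypos s) ≢ k * suc (xpos s)

-- Lengths of the maximal runs of consecutive east steps, in order of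
-- appearance.  The argument a is the length of the run currently open.
eruns : ℕ → List Step → List ℕ
eruns zero    []      = []
eruns (suc a) []      = suc a ∷ []
eruns a       (E ∷ s) = eruns (suc a) s
eruns zero    (N ∷ s) = eruns zero s
eruns zero    (D ∷ s) = eruns zero s
eruns (suc a) (N ∷ s) = suc a ∷ eruns zero s
eruns (suc a) (D ∷ s) = suc a ∷ eruns zero s

runs : List Step → List ℕ
runs = eruns zero

IsPartition : List ℕ → Set
IsPartition λs = All (1 ≤_) λs × Linked (λ a b → b ≤ a) λs

mult : ℕ → List ℕ → ℕ
mult i λs = length (filter (i ≟_) λs)

-- m_λ = m_1(λ)! m_2(λ)! ... (indices 0..|λ| suffice; m_0 = 0 contributes 0! = 1).
mλ : List ℕ → ℕ
mλ λs = product (map (λ i → mult i λs !) (upTo (suc (sum λs))))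

{-# OPTIONS --safe #-}
module Submission where

-- Removing the last run of east steps of a path, and then the north or diagonal
-- step before it, gives a recursion for the number F of paths from (0,0) to
-- (X,y) whose runs form a given multiset of l numbers with sum m and
-- multiplicities mᵢ.  Its solution, valid whenever kX ≤ y, is
--
--   F · ∏ mᵢ! = (y+1)ₗ · C(K−1,v−1) − (y)ₗ₋₁ · k · m · C(K,v),   v = K − X + m,
--
-- where (x)ₗ is the falling factorial and K is the number of heights
-- kj + r ≤ y (j ≥ 0) at which a diagonal step may end.  Removing a run leaves v and K
-- unchanged, so this step is an identity between falling factorials; crossing
-- a height kj + r is Pascal's rule in (K,v).  On the line y = kX one has
-- K = X and v = m, and the formula collapses to a product.  The condition of
-- not touching the line amounts to k(x+1) ≤ y for a diagonal step starting at
-- (x,y), the same condition as for an east step, whence the independence of r.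

open import Defs
open import Data.Nat
open import Data.Nat.Properties
open import Data.Nat.Combinatorics using (_C_; nCk+nC[k+1]≡[n+1]C[k+1]; nC1≡n)
open import Data.Nat.Combinatorics.Specification using (k>n⇒nCk≡0)
open import Data.Nat.ListAction using (sum; product)
open import Data.Nat.ListAction.Properties using (sum-++; sum-↭)
open import Data.Nat.Tactic.RingSolver using (solve-∀)
open import Data.List using (List; []; _∷_; _++_; _∷ʳ_; length; map; replicate; concat; reverse; applyUpTo)
open import Data.List.Properties
  using (map-∘; map-applyUpTo; length-++; length-map; length-replicate; filter-accept; filter-reject; filter-none;
         ++-cancelˡ; ++-assoc; ++-identityʳ; ∷-injectiveʳ; reverse-++; unfold-reverse; reverse-involutive; reverse-injective)
open import Data.List.Membership.Propositional using (_∈_)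
open import Data.List.Membership.Propositional.Properties
  using (∈-map⁺; ∈-map⁻; ∈-++⁺ˡ; ∈-++⁺ʳ; ∈-++⁻; ∈-concat⁺′; ∈-concat⁻′)
open import Data.List.Relation.Binary.Disjoint.Propositional using (Disjoint)
open import Data.List.Relation.Binary.Permutation.Propositional
  using (_↭_; ↭-refl; ↭-trans; ↭-reflexive; ↭-sym; prep; module PermutationReasoning)
open import Data.List.Relation.Binary.Permutation.Propositional.Properties as Perm
  using (shift; ++⁺ˡ; ++⁺ʳ; ++-comm; drop-∷; ∈-resp-↭; ↭-length; ↭-reverse)
open import Data.List.Relation.Unary.All as All using (All; []; _∷_)
import Data.List.Relation.Unary.All.Properties as All
open import Data.List.Relation.Unary.AllPairs as AllPairs using (AllPairs; []; _∷_)
import Data.List.Relation.Unary.AllPairs.Properties as AllPairs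
open import Data.List.Relation.Unary.Any using (here; there)
open import Data.List.Relation.Unary.Unique.Propositional using (Unique)
import Data.List.Relation.Unary.Unique.Propositional.Properties as Unique
open import Data.Product as Product using (Σ; _×_; _,_; ∃; ∃₂; proj₁; proj₂; map₂)
open import Data.Sum using (inj₁; inj₂)
open import Function using (_∘_)
open import Function.Bundles using (_⇔_; mk⇔; module Equivalence)
open import Relation.Binary.PropositionalEquality
open import Relation.Nullary
open import Relation.Nullary.Decidable using (_×-dec_)
open Equivalence using (to; from)

-- Binomial coefficients and falling factorials

C-absorption : ∀ n k → suc k * (suc n C suc k) ≡ suc n * (n C k)
C-absorption zero zero = refl
C-absorption zero (suc k) = *-zeroʳ k
C-absorption (suc n) zero = trans (*-identityˡ _) (trans (nC1≡n (2 + n)) (sym (*-identityʳ (2 + n))))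
C-absorption (suc n) (suc k) = begin
  suc (suc k) * (suc (suc n) C suc (suc k))   ≡⟨ cong (suc (suc k) *_) (nCk+nC[k+1]≡[n+1]C[k+1] (suc n) (suc k)) ⟨
  suc (suc k) * (a + b)                       ≡⟨ split k a b ⟩
  suc k * a + a + suc (suc k) * b             ≡⟨ cong₂ (λ u v → u + a + v) (C-absorption n k) (C-absorption n (suc k)) ⟩
  suc n * (n C k) + a + suc n * (n C suc k)   ≡⟨ join n (n C k) (n C suc k) a ⟩
  suc n * (n C k + n C suc k) + a             ≡⟨ cong (λ u → suc n * u + a) (nCk+nC[k+1]≡[n+1]C[k+1] n k) ⟩
  suc n * a + a                               ≡⟨ +-comm (suc n * a) a ⟩
  suc (suc n) * a                             ∎
  where
  open ≡-Reasoning
  a = suc n C suc k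
  b = suc n C suc (suc k)
  split : ∀ k a b → suc (suc k) * (a + b) ≡ suc k * a + a + suc (suc k) * b
  split = solve-∀
  join : ∀ n x y a → suc n * x + a + suc n * y ≡ suc n * (x + y) + a
  join = solve-∀

-- The binomial coefficient "n − 1 over k − 1", read as 1 at n = k = 0:
-- the number of compositions of n into k parts.
comps : ℕ → ℕ → ℕ
comps zero    zero    = 1
comps zero    (suc k) = 0
comps (suc n) zero    = 0
comps (suc n) (suc k) = n C k

-- The convention `comps 0 0` = 1 is what makes the rule hold at n = k = 0.
comps-pascal : ∀ n k → comps (suc n) (suc k) ≡ comps n k + comps n (suc k)
comps-pascal zero    zero    = refl
comps-pascal zero    (suc k) = refl
comps-pascal (suc n) zero    = refl
comps-pascal (suc n) (suc k) = sym (nCk+nC[k+1]≡[n+1]C[k+1] n k)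

comps-absorption : ∀ n k → k * (n C k) ≡ n * comps n k
comps-absorption zero    zero    = refl
comps-absorption zero    (suc k) = *-zeroʳ k
comps-absorption (suc n) zero    = sym (*-zeroʳ n)
comps-absorption (suc n) (suc k) = C-absorption n k

comps-> : ∀ {n k} → n < k → comps n k ≡ 0
comps-> {zero}  {suc k} _         = refl
comps-> {suc n} {suc k} (s≤s n<k) = k>n⇒nCk≡0 n<k

falling : ℕ → ℕ → ℕ
falling x l = (x C l) * l !

falling-absorption : ∀ x l → falling (suc x) (suc l) ≡ suc x * falling x l
falling-absorption x l = begin
  (suc x C suc l) * (suc l * l !)   ≡⟨ assoc (suc x C suc l) (suc l) (l !) ⟩
  suc l * (suc x C suc l) * l !     ≡⟨ cong (_* l !) (C-absorption x l) ⟩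
  suc x * (x C l) * l !             ≡⟨ *-assoc (suc x) (x C l) (l !) ⟩
  suc x * ((x C l) * l !)           ∎
  where
  open ≡-Reasoning
  assoc : ∀ a b c → a * (b * c) ≡ b * a * c
  assoc = solve-∀

-- The discrete derivative of the falling factorial, the identity behind the step from paths without
-- a last run to all paths.
falling-pascal : ∀ x l → falling (suc x) (suc l) ≡ falling x (suc l) + suc l * falling x l
falling-pascal x l = begin
  (suc x C suc l) * (suc l * l !)                          ≡⟨ cong (_* (suc l * l !)) (nCk+nC[k+1]≡[n+1]C[k+1] x l) ⟨
  ((x C l) + (x C suc l)) * (suc l * l !)                  ≡⟨ distrib (x C l) (x C suc l) l (l !) ⟩
  (x C suc l) * (suc l * l !) + suc l * ((x C l) * l !)    ∎
  where
  open ≡-Reasoning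
  distrib : ∀ a b l f → (a + b) * (suc l * f) ≡ b * (suc l * f) + suc l * (a * f)
  distrib = solve-∀

-- This is (x)ₗ₋₁. The value 0 at l = 0 is a default: in the count it multiplies a factor m, which
-- is 0 when there are no runs.
falling⁻ : ℕ → ℕ → ℕ
falling⁻ x zero    = 0
falling⁻ x (suc l) = falling x l

-- Multisets given by multiplicities

-- A multiset of positive integers is given by its list of multiplicities;
-- with offset o, the first entry is the multiplicity of 1 + o.
expand : ℕ → List ℕ → List ℕ
expand o []       = []
expand o (c ∷ ms) = replicate c (suc o) ++ expand (suc o) ms

weight : List ℕ → ℕ
weight ms = product (map _! ms)

wsum : (ℕ → ℕ) → ℕ → List ℕ → ℕ
wsum h o []       = 0
wsum h o (c ∷ ms) = c * h (suc o) + wsum h (suc o) ms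

total : ℕ → List ℕ → ℕ
total = wsum (λ a → a)

-- One entry for each distinct part rather than each copy: paths ending in a run of a given length
-- must be listed once, whichever copy the run is taken to be.
removals : ℕ → List ℕ → List (ℕ × List ℕ)
removals o []           = []
removals o (zero ∷ ms)  = map (map₂ (0 ∷_)) (removals (suc o) ms)
removals o (suc c ∷ ms) = (suc o , c ∷ ms) ∷ map (map₂ (suc c ∷_)) (removals (suc o) ms)

sum-replicate : ∀ c a → sum (replicate c a) ≡ c * a
sum-replicate zero    a = refl
sum-replicate (suc c) a = cong (a +_) (sum-replicate c a)

length-expand : ∀ o ms → length (expand o ms) ≡ sum ms
length-expand o []       = refl
length-expand o (c ∷ ms) = trans (length-++ (replicate c (suc o)))
  (cong₂ _+_ (length-replicate c) (length-expand (suc o) ms))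

sum-expand : ∀ o ms → sum (expand o ms) ≡ total o ms
sum-expand o []       = refl
sum-expand o (c ∷ ms) = trans (sum-++ (replicate c (suc o)) _)
  (cong₂ _+_ (sum-replicate c (suc o)) (sum-expand (suc o) ms))

removals-↭ : ∀ o ms {a ms′} → (a , ms′) ∈ removals o ms → expand o ms ↭ a ∷ expand o ms′
removals-↭ o (zero ∷ ms) p with ∈-map⁻ _ p
... | (a , ms″) , q , refl = removals-↭ (suc o) ms q
removals-↭ o (suc c ∷ ms) (here refl) = ↭-refl
removals-↭ o (suc c ∷ ms) (there p) with ∈-map⁻ _ p
... | (a , ms″) , q , refl = ↭-trans
  (++⁺ˡ (replicate (suc c) (suc o)) (removals-↭ (suc o) ms q))
  (shift a (replicate (suc c) (suc o)) (expand (suc o) ms″))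

∈-replicate⁻ : ∀ {a b : ℕ} c → a ∈ replicate c b → a ≡ b
∈-replicate⁻ (suc c) (here eq) = eq
∈-replicate⁻ (suc c) (there p) = ∈-replicate⁻ c p

removals-complete : ∀ o ms {a} → a ∈ expand o ms → ∃ λ ms′ → (a , ms′) ∈ removals o ms
removals-complete o (zero ∷ ms) p = Product.map (0 ∷_) (∈-map⁺ _) (removals-complete (suc o) ms p)
removals-complete o (suc c ∷ ms) p with ∈-++⁻ (replicate (suc c) (suc o)) p
... | inj₁ q rewrite ∈-replicate⁻ (suc c) q = c ∷ ms , here refl
... | inj₂ q = Product.map (suc c ∷_) (there ∘ ∈-map⁺ _) (removals-complete (suc o) ms q)

removals-> : ∀ o ms → All ((o <_) ∘ proj₁) (removals o ms)
removals-> o []           = []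
removals-> o (zero ∷ ms)  = All.map⁺ (All.map (<-trans (n<1+n o)) (removals-> (suc o) ms))
removals-> o (suc c ∷ ms) = n<1+n o ∷ All.map⁺ (All.map (<-trans (n<1+n o)) (removals-> (suc o) ms))

removals-distinct : ∀ o ms → AllPairs (λ u v → proj₁ u ≢ proj₁ v) (removals o ms)
removals-distinct o []           = []
removals-distinct o (zero ∷ ms)  = AllPairs.map⁺ (removals-distinct (suc o) ms)
removals-distinct o (suc c ∷ ms) = All.map⁺ (All.map <⇒≢ (removals-> (suc o) ms))
  ∷ AllPairs.map⁺ (removals-distinct (suc o) ms)

-- Removing a copy of a divides `weight` by the multiplicity of a. Scaled by `weight ms`, the sum
-- over distinct parts therefore becomes a sum over all copies, each contributing one instance of
-- the hypothesis. In the induction q collects the factorials of the multiplicities already passed.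
sum-removals : ∀ γ δ h q g o ms →
  (∀ {a ms′} → (a , ms′) ∈ removals o ms → q * weight ms′ * g (a , ms′) + γ * h a ≡ δ) →
  q * weight ms * sum (map g (removals o ms)) + γ * wsum h o ms ≡ sum ms * δ
sum-removals γ δ h q g o [] H = zeros (q * 1) γ
  where
  zeros : ∀ x y → x * 0 + y * 0 ≡ 0
  zeros = solve-∀
sum-removals γ δ h q g o (zero ∷ ms) H
  rewrite sym (map-∘ {g = g} {f = map₂ (0 ∷_)} (removals (suc o) ms))
        | +-identityʳ (weight ms) =
  sum-removals γ δ h q (g ∘ map₂ (0 ∷_)) (suc o) ms λ {a} {ms′} p →
    trans (cong (λ w → q * w * g (a , 0 ∷ ms′) + γ * h a) (sym (+-identityʳ (weight ms′)))) (H (∈-map⁺ _ p))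
sum-removals γ δ h q g o (suc c ∷ ms) H
  rewrite sym (map-∘ {g = g} {f = map₂ (suc c ∷_)} (removals (suc o) ms)) = begin
  q * (suc c ! * w) * (g₀ + S) + γ * (suc c * h (suc o) + T)
    ≡⟨ split q (c !) w g₀ S γ (suc c) (h (suc o)) T ⟩
  suc c * (q * (c ! * w) * g₀ + γ * h (suc o)) + (q * suc c ! * w * S + γ * T)
    ≡⟨ cong₂ (λ u v → suc c * u + v) (H (here refl))
         (sum-removals γ δ h (q * suc c !) (g ∘ map₂ (suc c ∷_)) (suc o) ms λ {a} {ms′} p →
           trans (cong (λ u → u * g (a , suc c ∷ ms′) + γ * h a) (*-assoc q (suc c !) (weight ms′)))
                 (H (there (∈-map⁺ _ p)))) ⟩
  suc c * δ + sum ms * δ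
    ≡⟨ *-distribʳ-+ δ (suc c) (sum ms) ⟨
  (suc c + sum ms) * δ ∎
  where
  open ≡-Reasoning
  w  = weight ms
  g₀ = g (suc o , c ∷ ms)
  S  = sum (map (g ∘ map₂ (suc c ∷_)) (removals (suc o) ms))
  T  = wsum h (suc o) ms
  split : ∀ q f w g₀ S γ c h T →
    q * (c * f * w) * (g₀ + S) + γ * (c * h + T)
      ≡ c * (q * (f * w) * g₀ + γ * h) + (q * (c * f) * w * S + γ * T)
  split = solve-∀

wsum-complement : ∀ t o ms → total o ms ≤ t → wsum (t ∸_) o ms + total o ms ≡ sum ms * t
wsum-complement t o []       _ = refl
wsum-complement t o (c ∷ ms) p = begin
  c * (t ∸ suc o) + S + (c * suc o + T)     ≡⟨ regroup (c * (t ∸ suc o)) S (c * suc o) T ⟩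
  c * (t ∸ suc o) + c * suc o + (S + T)     ≡⟨ cong₂ _+_ (entry c p) (wsum-complement t (suc o) ms (m+n≤o⇒n≤o (c * suc o) p)) ⟩
  c * t + sum ms * t                        ≡⟨ *-distribʳ-+ t c (sum ms) ⟨
  (c + sum ms) * t                          ∎
  where
  open ≡-Reasoning
  S = wsum (t ∸_) (suc o) ms
  T = total (suc o) ms
  regroup : ∀ a b c d → a + b + (c + d) ≡ a + c + (b + d)
  regroup = solve-∀
  entry : ∀ c → c * suc o + T ≤ t → c * (t ∸ suc o) + c * suc o ≡ c * t
  -- With multiplicity 0 the size `suc o` may exceed t; the truncated difference is then multiplied
  -- by 0.
  entry zero    _ = refl
  entry (suc c) p = trans (sym (*-distribˡ-+ (suc c) (t ∸ suc o) (suc o)))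
    (cong (suc c *_) (m∸n+n≡m (≤-trans (m≤m+n (suc o) (c * suc o)) (m+n≤o⇒m≤o _ p))))

expand-suc : ∀ o f f′ j n → j < n → f′ j ≡ suc (f j) → (∀ i → i ≢ j → f′ i ≡ f i) →
  expand o (applyUpTo f′ n) ↭ suc (o + j) ∷ expand o (applyUpTo f n)
expand-suc o f f′ zero (suc n) _ at off rewrite at | +-identityʳ o =
  prep (suc o) (++⁺ˡ (replicate (f 0) (suc o)) (↭-reflexive (cong (expand (suc o)) (applyUpTo-cong n (λ i → off (suc i) λ ())))))
  where
  applyUpTo-cong : ∀ {f g : ℕ → ℕ} n → (∀ i → f i ≡ g i) → applyUpTo f n ≡ applyUpTo g n
  applyUpTo-cong zero    eq = refl
  applyUpTo-cong (suc n) eq = cong₂ _∷_ (eq 0) (applyUpTo-cong n (eq ∘ suc))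
expand-suc o f f′ (suc j) (suc n) (s≤s j<n) at off rewrite off 0 (λ ()) | +-suc o j =
  ↭-trans (++⁺ˡ (replicate (f 0) (suc o)) (expand-suc (suc o) (f ∘ suc) (f′ ∘ suc) j n j<n at
            (λ i i≢j → off (suc i) (i≢j ∘ suc-injective))))
          (shift _ (replicate (f 0) (suc o)) _)

mults : ℕ → List ℕ → List ℕ
mults n as = applyUpTo (λ i → mult (suc i) as) n

-- Only up to order, as `expand` lists parts increasingly. Induction on the list: each entry raises
-- a single multiplicity by 1, while n stays fixed.
expand-mults : ∀ n as → All (1 ≤_) as → All (_≤ n) as → expand 0 (mults n as) ↭ as
expand-mults n [] [] [] = ↭-reflexive (expand-0 0 n)
  where
  expand-0 : ∀ o n → expand o (applyUpTo (λ _ → 0) n) ≡ []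
  expand-0 o zero    = refl
  expand-0 o (suc n) = expand-0 (suc o) n
expand-mults n (suc a ∷ as) (_ ∷ pos) (a<n ∷ bd) =
  ↭-trans (expand-suc 0 (λ i → mult (suc i) as) _ a n a<n at off) (prep (suc a) (expand-mults n as pos bd))
  where
  at : mult (suc a) (suc a ∷ as) ≡ suc (mult (suc a) as)
  at = cong length (filter-accept (suc a ≟_) refl)
  off : ∀ i → i ≢ a → mult (suc i) (suc a ∷ as) ≡ mult (suc i) as
  off i i≢a = cong length (filter-reject (suc i ≟_) (i≢a ∘ suc-injective))

when : ∀ {p a} {P : Set p} {A : Set a} → Dec P → List A → List A
when (yes _) xs = xs
when (no  _) xs = []

when-yes : ∀ {p a} {P : Set p} {A : Set a} (d : Dec P) {xs : List A} → P → when d xs ≡ xs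
when-yes (yes _) p = refl
when-yes (no ¬p) p = contradiction p ¬p

when-no : ∀ {p a} {P : Set p} {A : Set a} (d : Dec P) {xs : List A} → ¬ P → when d xs ≡ []
when-no (yes p) ¬p = contradiction p ¬p
when-no (no _)  ¬p = refl

length-concat-map : ∀ {a b} {A : Set a} {B : Set b} (f : A → List B) xs →
  length (concat (map f xs)) ≡ sum (map (length ∘ f) xs)
length-concat-map f []       = refl
length-concat-map f (x ∷ xs) = trans (length-++ (f x)) (cong (length (f x) +_) (length-concat-map f xs))

sum-removal : ∀ o ms {a ms′} → (a , ms′) ∈ removals o ms → sum ms ≡ suc (sum ms′)
sum-removal o ms {a} {ms′} p = begin
  sum ms                          ≡⟨ length-expand o ms ⟨
  length (expand o ms)            ≡⟨ ↭-length (removals-↭ o ms p) ⟩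
  suc (length (expand o ms′))     ≡⟨ cong suc (length-expand o ms′) ⟩
  suc (sum ms′)                   ∎
  where open ≡-Reasoning

total-removal : ∀ o ms {a ms′} → (a , ms′) ∈ removals o ms → total o ms ≡ a + total o ms′
total-removal o ms {a} {ms′} p = begin
  total o ms                  ≡⟨ sum-expand o ms ⟨
  sum (expand o ms)           ≡⟨ sum-↭ (removals-↭ o ms p) ⟩
  a + sum (expand o ms′)      ≡⟨ cong (a +_) (sum-expand o ms′) ⟩
  a + total o ms′             ∎
  where open ≡-Reasoning

sum≤total : ∀ o ms → sum ms ≤ total o ms
sum≤total o []       = z≤n
sum≤total o (c ∷ ms) = +-mono-≤ (m≤m*n c (suc o)) (sum≤total (suc o) ms)

sum≡0⇒total≡0 : ∀ o ms → sum ms ≡ 0 → total o ms ≡ 0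
sum≡0⇒total≡0 o []          _  = refl
sum≡0⇒total≡0 o (zero ∷ ms) eq = sum≡0⇒total≡0 (suc o) ms eq

sum≡0⇒weight≡1 : ∀ ms → sum ms ≡ 0 → weight ms ≡ 1
sum≡0⇒weight≡1 []          _  = refl
sum≡0⇒weight≡1 (zero ∷ ms) eq = trans (+-identityʳ _) (sum≡0⇒weight≡1 ms eq)

-- How the counting formula passes from paths ending in a rise to all paths: b of
-- them lack a last run, s of them have one, and S is the sum of m − a over the
-- possible last runs a.
add-block : ∀ w b s z k m β α l S → (l ≡ 0 → m ≡ 0) →
  w * b + falling⁻ z l * (k * (m * β)) ≡ falling (suc z) l * α →
  1 * w * s + falling⁻ z (pred l) * (k * β) * S ≡ l * (falling (suc z) (pred l) * α) →
  S + m ≡ l * m →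
  w * (b + s) + falling⁻ (suc z) l * (k * (m * β)) ≡ falling (suc (suc z)) l * α
add-block w b s z k m β α zero S m≡0 V R W rewrite m≡0 refl = begin
  w * (b + s) + 0                 ≡⟨ split w b s (k * β) ⟩
  w * b + 0 + (1 * w * s + 0)     ≡⟨ cong₂ _+_ V R ⟩
  α + 0 + 0                       ≡⟨ +-identityʳ (α + 0) ⟩
  α + 0                           ∎
  where
  open ≡-Reasoning
  split : ∀ w b s x → w * (b + s) + 0 ≡ w * b + 0 + (1 * w * s + 0)
  split = solve-∀
add-block w b s z k m β α (suc l) S _ V R W = begin
  -- The coefficient (z+1)ₗ splits by the discrete derivative: its first share completes V, its
  -- second, with S = l m, completes R. The right-hand sides recombine by the same rule.
  w * (b + s) + falling (suc z) l * (k * (m * β))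
    ≡⟨ cong (λ f → w * (b + s) + f * (k * (m * β))) (falling-rec l) ⟩
  w * (b + s) + (f + l * f⁻) * (k * (m * β))
    ≡⟨ split w b s f l f⁻ k m β ⟩
  (w * b + f * (k * (m * β))) + (1 * w * s + f⁻ * (k * β) * (l * m))
    ≡⟨ cong (λ t → (w * b + f * (k * (m * β))) + (1 * w * s + f⁻ * (k * β) * t)) S≡lm ⟨
  (w * b + f * (k * (m * β))) + (1 * w * s + f⁻ * (k * β) * S)
    ≡⟨ cong₂ _+_ V R ⟩
  falling (suc z) (suc l) * α + suc l * (falling (suc z) l * α)
    ≡⟨ join (falling (suc z) (suc l)) α (suc l) (falling (suc z) l) ⟩
  (falling (suc z) (suc l) + suc l * falling (suc z) l) * α
    ≡⟨ cong (_* α) (falling-pascal (suc z) l) ⟨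
  falling (suc (suc z)) (suc l) * α ∎
  where
  open ≡-Reasoning
  f  = falling z l
  f⁻ = falling⁻ z l
  S≡lm : S ≡ l * m
  S≡lm = +-cancelʳ-≡ m S (l * m) (trans W (+-comm m (l * m)))
  falling-rec : ∀ l → falling (suc z) l ≡ falling z l + l * falling⁻ z l
  falling-rec zero    = refl
  falling-rec (suc l) = falling-pascal z l
  split : ∀ w b s f l f⁻ k m β → w * (b + s) + (f + l * f⁻) * (k * (m * β))
    ≡ (w * b + f * (k * (m * β))) + (1 * w * s + f⁻ * (k * β) * (l * m))
  split = solve-∀
  join : ∀ x α l y → x * α + l * (y * α) ≡ (x + l * y) * α
  join = solve-∀

-- Runs of reversed paths

module _ {p a} {P : Set p} {A : Set a} where

  ∈-when⁻ : ∀ (d : Dec P) {xs : List A} {v} → v ∈ when d xs → P × v ∈ xs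
  ∈-when⁻ (yes p) v∈xs = p , v∈xs

  ∈-when⁺ : ∀ (d : Dec P) {xs : List A} {v} → P → v ∈ xs → v ∈ when d xs
  ∈-when⁺ (yes _) p v∈xs = v∈xs
  ∈-when⁺ (no ¬p) p _    = contradiction p ¬p

  when-unique : ∀ (d : Dec P) {xs : List A} → Unique xs → Unique (when d xs)
  when-unique (yes _) u = u
  when-unique (no  _) _ = []

eruns-E : ∀ a s → eruns a (E ∷ s) ≡ eruns (suc a) s
eruns-E zero    s = refl
eruns-E (suc a) s = refl

eruns-replicate : ∀ a b s → eruns b (replicate a E ++ s) ≡ eruns (a + b) s
eruns-replicate zero    b s = refl
eruns-replicate (suc a) b s = begin
  eruns b (E ∷ replicate a E ++ s)       ≡⟨ eruns-E b (replicate a E ++ s) ⟩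
  eruns (suc b) (replicate a E ++ s)     ≡⟨ eruns-replicate a (suc b) s ⟩
  eruns (a + suc b) s                    ≡⟨ cong (λ c → eruns c s) (+-suc a b) ⟩
  eruns (suc a + b) s                    ∎
  where open ≡-Reasoning

runs-replicate : ∀ a → runs (replicate a E) ≡ eruns a []
runs-replicate a = begin
  runs (replicate a E)           ≡⟨ cong runs (++-identityʳ (replicate a E)) ⟨
  runs (replicate a E ++ [])     ≡⟨ eruns-replicate a 0 [] ⟩
  eruns (a + 0) []               ≡⟨ cong (λ c → eruns c []) (+-identityʳ a) ⟩
  eruns a []                     ∎
  where open ≡-Reasoning

data Rise : Step → Set where
  north : Rise N
  diag  : Rise D

-- `eruns a []` is the open run as a list, empty for a = 0; this merges the cases with and without
-- an open run.
eruns-rise : ∀ {v} → Rise v → ∀ a t → eruns a (v ∷ t) ≡ eruns a [] ++ runs t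
eruns-rise north zero    t = refl
eruns-rise north (suc a) t = refl
eruns-rise diag  zero    t = refl
eruns-rise diag  (suc a) t = refl

eruns-++-rise : ∀ {v} → Rise v → ∀ a s t → eruns a (s ++ v ∷ t) ≡ eruns a s ++ runs t
eruns-++-rise rise a [] t = eruns-rise rise a t
eruns-++-rise {v} rise a (E ∷ s) t rewrite eruns-E a s | eruns-E a (s ++ v ∷ t) = eruns-++-rise rise (suc a) s t
eruns-++-rise {v} rise a (N ∷ s) t rewrite eruns-rise north a s | eruns-rise north a (s ++ v ∷ t)
  | eruns-++-rise rise 0 s t = sym (++-assoc (eruns a []) (runs s) (runs t))
eruns-++-rise {v} rise a (D ∷ s) t rewrite eruns-rise diag a s | eruns-rise diag a (s ++ v ∷ t)
  | eruns-++-rise rise 0 s t = sym (++-assoc (eruns a []) (runs s) (runs t))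

-- The open run stands for a east steps read earlier; reversal moves them to the end, hence the
-- appended `replicate a E`. A rise cuts the list of runs into two independent pieces, which trade
-- places.
eruns-reverse : ∀ a q → eruns a q ↭ runs (reverse q ++ replicate a E)
eruns-reverse-rise : ∀ {v} → Rise v → ∀ a q → eruns a (v ∷ q) ↭ runs (reverse (v ∷ q) ++ replicate a E)

runs-reverse : ∀ q → runs q ↭ runs (reverse q)
runs-reverse q = ↭-trans (eruns-reverse 0 q) (↭-reflexive (cong runs (++-identityʳ (reverse q))))

eruns-reverse a []      = ↭-reflexive (sym (runs-replicate a))
eruns-reverse a (E ∷ q) = ↭-trans (↭-reflexive (eruns-E a q)) (↭-trans (eruns-reverse (suc a) q)
  (↭-reflexive (cong runs (sym (trans (cong (_++ replicate a E) (unfold-reverse E q)) (++-assoc (reverse q) (E ∷ []) (replicate a E)))))))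
eruns-reverse a (N ∷ q) = eruns-reverse-rise north a q
eruns-reverse a (D ∷ q) = eruns-reverse-rise diag a q

eruns-reverse-rise {v} rise a q = begin
  eruns a (v ∷ q)                                  ≡⟨ eruns-rise rise a q ⟩
  eruns a [] ++ runs q                             ↭⟨ ++-comm (eruns a []) (runs q) ⟩
  runs q ++ eruns a []                             ↭⟨ ++⁺ʳ (eruns a []) (runs-reverse q) ⟩
  runs (reverse q) ++ eruns a []                   ≡⟨ cong (runs (reverse q) ++_) (runs-replicate a) ⟨
  runs (reverse q) ++ runs (replicate a E)         ≡⟨ eruns-++-rise rise 0 (reverse q) (replicate a E) ⟨
  runs (reverse q ++ v ∷ replicate a E)            ≡⟨ cong runs (++-assoc (reverse q) (v ∷ []) (replicate a E)) ⟨
  runs ((reverse q ∷ʳ v) ++ replicate a E)         ≡⟨ cong (λ s → runs (s ++ replicate a E)) (unfold-reverse v q) ⟨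
  runs (reverse (v ∷ q) ++ replicate a E)          ∎
  where open PermutationReasoning

lead : List Step → ℕ
lead (E ∷ q) = suc (lead q)
lead _       = 0

lead-replicate : ∀ a q → lead (replicate a E ++ q) ≡ a + lead q
lead-replicate zero    q = refl
lead-replicate (suc a) q = cong suc (lead-replicate a q)

runs-block : ∀ a q → lead q ≡ 0 → runs (replicate (suc a) E ++ q) ≡ suc a ∷ runs q
runs-block a q lead≡0 = trans (eruns-replicate (suc a) 0 q) (trans (cong (λ c → eruns c q) (+-identityʳ (suc a))) (close q lead≡0))
  where
  close : ∀ q → lead q ≡ 0 → eruns (suc a) q ≡ suc a ∷ runs q
  close []      _ = refl
  close (N ∷ q) _ = refl
  close (D ∷ q) _ = refl

-- The entry `(0 , ms)` stands for the absence of a last run; for positive a the block is a maximal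
-- run because `lead q` is 0.
block-runs⁺ : ∀ ms {a ms′} q → lead q ≡ 0 → (a , ms′) ∈ (0 , ms) ∷ removals 0 ms →
  runs q ↭ expand 0 ms′ → runs (replicate a E ++ q) ↭ expand 0 ms
block-runs⁺ ms q _ (here refl) p = p
block-runs⁺ ms {zero}  q _ (there m) p = contradiction (All.lookup (removals-> 0 ms) m) λ ()
block-runs⁺ ms {suc a} q lead≡0 (there m) p =
  ↭-trans (↭-reflexive (runs-block a q lead≡0)) (↭-trans (prep (suc a) p) (↭-sym (removals-↭ 0 ms m)))

block-runs⁻ : ∀ ms a q → lead q ≡ 0 → runs (replicate a E ++ q) ↭ expand 0 ms →
  ∃ λ ms′ → (a , ms′) ∈ (0 , ms) ∷ removals 0 ms × runs q ↭ expand 0 ms′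
block-runs⁻ ms zero    q _ p = ms , here refl , p
block-runs⁻ ms (suc a) q lead≡0 p with ↭-trans (↭-reflexive (sym (runs-block a q lead≡0))) p
... | p′ with removals-complete 0 ms (∈-resp-↭ p′ (here refl))
...   | ms′ , m = ms′ , there m , drop-∷ (↭-trans p′ (removals-↭ 0 ms m))

sum≡0⇒expand≡[] : ∀ o ms → sum ms ≡ 0 → expand o ms ≡ []
sum≡0⇒expand≡[] o []          _  = refl
sum≡0⇒expand≡[] o (zero ∷ ms) eq = sum≡0⇒expand≡[] (suc o) ms eq

xpos-reverse : ∀ p → xpos (reverse p) ≡ xpos p
xpos-reverse p = sum-↭ (Perm.map⁺ dx (↭-reverse p))

ypos-reverse : ∀ p → ypos (reverse p) ≡ ypos p
ypos-reverse p = sum-↭ (Perm.map⁺ dy (↭-reverse p))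

reverse-∷-++ : ∀ (s : List Step) v t → reverse (s ++ v ∷ t) ≡ reverse t ++ v ∷ reverse s
reverse-∷-++ s v t = begin
  reverse (s ++ v ∷ t)                 ≡⟨ reverse-++ s (v ∷ t) ⟩
  reverse (v ∷ t) ++ reverse s         ≡⟨ cong (_++ reverse s) (unfold-reverse v t) ⟩
  (reverse t ∷ʳ v) ++ reverse s        ≡⟨ ++-assoc (reverse t) (v ∷ []) (reverse s) ⟩
  reverse t ++ v ∷ reverse s           ∎
  where open ≡-Reasoning

reverse-flip : ∀ {p q : List Step} → reverse p ≡ q → p ≡ reverse q
reverse-flip {p} eq = trans (sym (reverse-involutive p)) (cong reverse eq)

-- Enumeration and counting

Paths : Set
Paths = List (List Step)

-- A family indexed by the abscissa of the end point and the multiset of runs.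
Family : Set
Family = ℕ → List ℕ → Paths

module SmallPaths (k r : ℕ) (1≤k : 1 ≤ k) (1≤r : 1 ≤ r) (r≤k : r ≤ k) where

  -- The number of heights k j + r ≤ y with j ≥ 0.
  rows : ℕ → ℕ
  rows zero = 0
  rows (suc y) with suc y ≟ k * rows y + r
  ... | yes _ = suc (rows y)
  ... | no  _ = rows y

  -- `k * rows y + r` is the first height kj + r above y; passing to y + 1 changes it only when y +
  -- 1 reaches it.
  rows-bounds : ∀ y → y < k * rows y + r × k * rows y + r ≤ y + k
  rows-bounds zero rewrite *-zeroʳ k = 1≤r , r≤k
  rows-bounds (suc y) with suc y ≟ k * rows y + r | rows-bounds y
  ... | no  ne | lo , hi = ≤∧≢⇒< lo ne , m≤n⇒m≤1+n hi
  ... | yes eq | _ = subst (suc y <_) (sym next) (m<m+n (suc y) 1≤k) , ≤-reflexive next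
    where
    next : k * suc (rows y) + r ≡ suc y + k
    next = trans (shuffle k (rows y) r) (cong (_+ k) (sym eq))
      where
      shuffle : ∀ k R r → k * suc R + r ≡ k * R + r + k
      shuffle = solve-∀

  k*-cancel-< : ∀ {m n} → k * m < k * suc n → m ≤ n
  k*-cancel-< {m} {n} p = s≤s⁻¹ (*-cancelˡ-< k m (suc n) p)

  rows-≥ : ∀ {X y} → k * X ≤ y → X ≤ rows y
  rows-≥ {X} {y} p = k*-cancel-< (begin-strict
    k * X              ≤⟨ p ⟩
    y                  <⟨ proj₁ (rows-bounds y) ⟩
    k * rows y + r     ≤⟨ +-monoʳ-≤ (k * rows y) r≤k ⟩
    k * rows y + k     ≡⟨ +-comm (k * rows y) k ⟩
    k + k * rows y     ≡⟨ *-suc k (rows y) ⟨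
    k * suc (rows y)   ∎)
    where open ≤-Reasoning

  -- Each range from kj + 1 to kj + k contains exactly one height kj + r, as 1 ≤ r ≤ k. So K = X on
  -- the line, and r drops out of the count.
  rows-on-line : ∀ {X y} → k * X ≡ y → rows y ≡ X
  rows-on-line {X} {y} eq = ≤-antisym (k*-cancel-< (begin-strict
    k * rows y         <⟨ m<m+n (k * rows y) 1≤r ⟩
    k * rows y + r     ≤⟨ proj₂ (rows-bounds y) ⟩
    y + k              ≡⟨ +-comm y k ⟩
    k + y              ≡⟨ cong (k +_) eq ⟨
    k + k * X          ≡⟨ *-suc k X ⟨
    k * suc X          ∎)) (rows-≥ (≤-reflexive eq))
    where open ≤-Reasoning

  -- Consecutive heights kj + r differ by k, and `rows-bounds` leaves room for only one, so j must
  -- be `rows y`. This makes (C2) decidable.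
  rows-aligned : ∀ {y j} → suc y ≡ k * j + r → suc y ≡ k * rows y + r
  rows-aligned {y} {j} eq = trans eq (cong (λ i → k * i + r) (≤-antisym
    (*-cancelˡ-≤ k {{>-nonZero 1≤k}} (+-cancelʳ-≤ r (k * j) (k * rows y)
      (≤-trans (≤-reflexive (sym eq)) (proj₁ (rows-bounds y)))))
    (k*-cancel-< (+-cancelʳ-< r (k * rows y) (k * suc j) (begin-strict
      k * rows y + r   ≤⟨ proj₂ (rows-bounds y) ⟩
      y + k            <⟨ n<1+n (y + k) ⟩
      suc y + k        ≡⟨ cong (_+ k) eq ⟩
      k * j + r + k    ≡⟨ shuffle k j r ⟩
      k * suc j + r    ∎)))))
    where
    open ≤-Reasoning
    shuffle : ∀ k j r → k * j + r + k ≡ k * suc j + r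
    shuffle = solve-∀

  -- Paths are enumerated as reversed lists of steps: the head is the last step.
  block : Family → ℕ → ℕ × List ℕ → Paths
  block B X (a , ms) = when (a ≤? X) (map (replicate a E ++_) (B (X ∸ a) ms))

  -- For B = vert y, both extend B y X ms and vert y X ms list paths to (X , y)
  -- with runs ms; the latter only those whose last step is not an east step.
  extend : Family → ℕ → Family
  extend B y X ms = when (k * X ≤? y) (concat (map (block B X) ((0 , ms) ∷ removals 0 ms)))

  -- `A` holds the paths at the height y where the diagonal step starts, whereas the abscissa is
  -- that of its end, so 0 admits none. The guard expresses (C1) and the absence of touching at
  -- once.
  diags : Family → ℕ → Family
  diags A y zero    ms = []
  diags A y (suc X) ms = when (k * suc X ≤? y) (map (D ∷_) (A X ms))

  vert : ℕ → Family
  -- The test is on `sum ms` because any list of zeros denotes the empty multiset.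
  vert zero    X ms = when ((X ≟ 0) ×-dec (sum ms ≟ 0)) ([] ∷ [])
  vert (suc y) X ms = map (N ∷_) (extend (vert y) y X ms)
    ++ when (suc y ≟ k * rows y + r) (diags (extend (vert y) y) y X ms)

  ending : ℕ → Family
  ending y = extend (vert y) y

  -- The formula for c paths, with both sides moved so that no subtraction occurs.
  record Count (K v y c : ℕ) (ms : List ℕ) : Set where
    constructor count
    field
      equation : weight ms * c + falling⁻ y (sum ms) * (k * (total 0 ms * (K C v)))
                 ≡ falling (suc y) (sum ms) * comps K v
  open Count

  -- The counting formula along the recursion.

  -- Both binomials vanish for K < v. This covers the cases without paths: a last run longer than X,
  -- a diagonal step ending at abscissa 0, runs at height 0.
  Count-vanishing : ∀ {K v y} ms → K < v → Count K v y 0 ms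
  Count-vanishing {K} {v} {y} ms K<v .equation
    rewrite k>n⇒nCk≡0 K<v | comps-> K<v = zeros (weight ms) (falling⁻ y (sum ms)) k (total 0 ms) (falling (suc y) (sum ms))
    where
    zeros : ∀ w f k m g → w * 0 + f * (k * (m * 0)) ≡ g * 0
    zeros = solve-∀

  -- For fixed y and `ms` the formula is linear in `K C v` and `comps K v`, and both obey Pascal's
  -- rule. Paths ending in a north step supply the term at v, those ending in a diagonal step the
  -- term at v + 1.
  Count-pascal : ∀ {K v y c c′} ms → Count K v y c ms → Count K (suc v) y c′ ms →
                 Count (suc K) (suc v) y (c + c′) ms
  Count-pascal {K} {v} {y} {c} {c′} ms (count p) (count q) .equation = begin
    w * (c + c′) + f * (k * (m * (suc K C suc v)))
      ≡⟨ cong (λ b → w * (c + c′) + f * (k * (m * b))) (nCk+nC[k+1]≡[n+1]C[k+1] K v) ⟨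
    w * (c + c′) + f * (k * (m * (K C v + K C suc v)))
      ≡⟨ split w c c′ f k m (K C v) (K C suc v) ⟩
    (w * c + f * (k * (m * (K C v)))) + (w * c′ + f * (k * (m * (K C suc v))))
      ≡⟨ cong₂ _+_ p q ⟩
    g * comps K v + g * comps K (suc v)
      ≡⟨ *-distribˡ-+ g (comps K v) (comps K (suc v)) ⟨
    g * (comps K v + comps K (suc v))
      ≡⟨ cong (g *_) (comps-pascal K v) ⟨
    g * comps (suc K) (suc v) ∎
    where
    open ≡-Reasoning
    w = weight ms
    m = total 0 ms
    f = falling⁻ y (sum ms)
    g = falling (suc y) (sum ms)
    split : ∀ w c c′ f k m a b → w * (c + c′) + f * (k * (m * (a + b)))
      ≡ (w * c + f * (k * (m * a))) + (w * c′ + f * (k * (m * b)))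
    split = solve-∀

  -- `VertCount y` concerns height y + 1 but keeps the falling factorials of height y: the rise
  -- alters only K and v, and adding the last run afterwards raises the factorials.
  VertCount EndingCount : ℕ → Set
  VertCount y = ∀ X ms → k * X ≤ suc y → Count (rows (suc y)) (rows (suc y) ∸ X + total 0 ms) y (length (vert (suc y) X ms)) ms
  EndingCount y = ∀ X ms → k * X ≤ y → Count (rows y) (rows y ∸ X + total 0 ms) y (length (ending y X ms)) ms

  -- No path reaches the line y = kx by a vertical or diagonal step; the formula
  -- gives 0 there because k m C(X,m) = k X C(X−1,m−1).
  Count-on-line : ∀ {X y} ms → k * X ≡ suc y → Count X (total 0 ms) y 0 ms
  Count-on-line {zero}  ms eq = contradiction (trans (sym (*-zeroʳ k)) eq) λ ()
  Count-on-line {suc X} {y} ms eq .equation with sum ms in sum-eq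
  -- Without runs m = 0, and `comps (suc X) 0` is 0, so both sides vanish.
  ... | zero rewrite sum≡0⇒total≡0 0 ms sum-eq = trans (+-identityʳ (weight ms * 0)) (trans (*-zeroʳ (weight ms)) (sym (*-zeroʳ (falling (suc y) 0))))
  ... | suc l = begin
    weight ms * 0 + falling y l * (k * (m * (suc X C m)))
      ≡⟨ cong (λ b → weight ms * 0 + falling y l * (k * b)) (comps-absorption (suc X) m) ⟩
    weight ms * 0 + falling y l * (k * (suc X * comps (suc X) m))
      ≡⟨ regroup (weight ms) (falling y l) k (suc X) (comps (suc X) m) ⟩
    (k * suc X) * falling y l * comps (suc X) m
      ≡⟨ cong (λ z → z * falling y l * comps (suc X) m) eq ⟩
    suc y * falling y l * comps (suc X) m
      ≡⟨ cong (_* comps (suc X) m) (falling-absorption y l) ⟨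
    falling (suc y) (suc l) * comps (suc X) m ∎
    where
    open ≡-Reasoning
    m = total 0 ms
    regroup : ∀ w f k X c → w * 0 + f * (k * (X * c)) ≡ (k * X) * f * c
    regroup = solve-∀

  length-vert : ∀ y X ms → length (vert (suc y) X ms)
    ≡ length (ending y X ms) + length (when (suc y ≟ k * rows y + r) (diags (ending y) y X ms))
  length-vert y X ms = trans (length-++ (map (N ∷_) (ending y X ms)))
    (cong (_+ length (when (suc y ≟ k * rows y + r) (diags (ending y) y X ms))) (length-map (N ∷_) (ending y X ms)))

  vert-count-on-line : ∀ y X ms → k * X ≡ suc y →
    Count (rows (suc y)) (rows (suc y) ∸ X + total 0 ms) y (length (vert (suc y) X ms)) ms
  vert-count-on-line y X ms on-line rewrite length-vert y X ms | rows-on-line on-line | n∸n≡0 X =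
    subst (λ c → Count X (total 0 ms) y c ms) (sym (cong₂ _+_ (cong length (when-no (k * X ≤? y) kX≰y))
      (cong length (when-[] (suc y ≟ k * rows y + r) (diags-empty X kX≰y))))) (Count-on-line ms on-line)
    where
    kX≰y : ¬ k * X ≤ y
    kX≰y = <⇒≱ (≤-reflexive (sym on-line))
    diags-empty : ∀ X → ¬ k * X ≤ y → diags (ending y) y X ms ≡ []
    diags-empty zero    _ = refl
    diags-empty (suc X) q = when-no (k * suc X ≤? y) q
    when-[] : ∀ {P : Set} (d : Dec P) {xs : Paths} → xs ≡ [] → when d xs ≡ []
    when-[] (yes _) eq = eq
    when-[] (no _)  _  = refl

  vert-count-above : ∀ y X ms → EndingCount y → k * X ≤ y →
    Count (rows (suc y)) (rows (suc y) ∸ X + total 0 ms) y (length (vert (suc y) X ms)) ms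
  vert-count-above y X ms ending-count kX≤y rewrite length-vert y X ms with suc y ≟ k * rows y + r
  ... | no _ = subst (λ c → Count (rows y) (rows y ∸ X + total 0 ms) y c ms) (sym (+-identityʳ _)) (ending-count X ms kX≤y)
  ... | yes _ = cases X kX≤y
    where
    K = rows y
    m = total 0 ms
    cases : ∀ X → k * X ≤ y →
      Count (suc K) (suc K ∸ X + m) y (length (ending y X ms) + length (diags (ending y) y X ms)) ms
    cases zero    p = Count-pascal ms (ending-count 0 ms p) (Count-vanishing ms (s≤s (m≤m+n K m)))
    cases (suc X) p = subst₂ (λ c v → Count (suc K) v y (length (ending y (suc X) ms) + c) ms)
      (sym (trans (cong length (when-yes (k * suc X ≤? y) p)) (length-map (D ∷_) (ending y X ms)))) (sym v-suc)
      (Count-pascal ms (ending-count (suc X) ms p)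
        (subst (λ v → Count K v y (length (ending y X ms)) ms) v-suc
          (ending-count X ms (≤-trans (*-monoʳ-≤ k (n≤1+n X)) p))))
      where
      v-suc : K ∸ X + m ≡ suc (K ∸ suc X + m)
      -- `rows-≥` makes `K ∸ suc X` a true difference, so moving the end one unit left raises v by
      -- exactly one.
      v-suc = cong (_+ m) (+-∸-assoc 1 (rows-≥ p))

  vert-count : ∀ y → EndingCount y → VertCount y
  vert-count y ending-count X ms kX≤1+y with m≤n⇒m<n∨m≡n kX≤1+y
  ... | inj₁ kX<1+y = vert-count-above y X ms ending-count (s≤s⁻¹ kX<1+y)
  ... | inj₂ kX≡1+y = vert-count-on-line y X ms kX≡1+y

  block-count : ∀ y → VertCount y → ∀ {X a ms ms′} → k * X ≤ suc y → total 0 ms ≡ a + total 0 ms′ →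
    Count (rows (suc y)) (rows (suc y) ∸ X + total 0 ms) y (length (block (vert (suc y)) X (a , ms′))) ms′
  block-count y vert-count {X} {a} {ms} {ms′} kX≤1+y split with a ≤? X
  ... | yes a≤X rewrite length-map (replicate a E ++_) (vert (suc y) (X ∸ a) ms′) =
    subst (λ v → Count K v y (length (vert (suc y) (X ∸ a) ms′)) ms′) v-eq
      (vert-count (X ∸ a) ms′ (≤-trans (*-monoʳ-≤ k (m∸n≤m X a)) kX≤1+y))
    where
    K = rows (suc y)
    m′ = total 0 ms′
    v-eq : K ∸ (X ∸ a) + m′ ≡ K ∸ X + total 0 ms
    v-eq = begin
      K ∸ (X ∸ a) + m′                            ≡⟨ cong (λ z → z ∸ (X ∸ a) + m′) (m∸n+n≡m (rows-≥ kX≤1+y)) ⟨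
      K ∸ X + X ∸ (X ∸ a) + m′                    ≡⟨ cong (_+ m′) (+-∸-assoc (K ∸ X) (m∸n≤m X a)) ⟩
      K ∸ X + (X ∸ (X ∸ a)) + m′                  ≡⟨ cong (λ z → K ∸ X + z + m′) (m∸[m∸n]≡n a≤X) ⟩
      K ∸ X + a + m′                              ≡⟨ +-assoc (K ∸ X) a m′ ⟩
      K ∸ X + (a + m′)                            ≡⟨ cong (K ∸ X +_) split ⟨
      K ∸ X + total 0 ms                          ∎
      where open ≡-Reasoning
  -- A run that does not fit has a > X, hence v ≥ K - X + a > K.
  ... | no a≰X = Count-vanishing ms′ (begin-strict
    K                       ≡⟨ m∸n+n≡m (rows-≥ kX≤1+y) ⟨
    K ∸ X + X               <⟨ +-monoʳ-< (K ∸ X) (≰⇒> a≰X) ⟩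
    K ∸ X + a               ≤⟨ +-monoʳ-≤ (K ∸ X) (m≤m+n a _) ⟩
    K ∸ X + (a + total 0 ms′)   ≡⟨ cong (K ∸ X +_) split ⟨
    K ∸ X + total 0 ms      ∎)
    where
    open ≤-Reasoning
    K = rows (suc y)

  length-ending : ∀ y X ms → k * X ≤ y → length (ending y X ms)
    ≡ length (vert y X ms) + sum (map (length ∘ block (vert y) X) (removals 0 ms))
  length-ending y X ms p = begin
    length (ending y X ms)
      ≡⟨ cong length (when-yes (k * X ≤? y) {concat (map (block (vert y) X) ((0 , ms) ∷ removals 0 ms))} p) ⟩
    length (concat (map (block (vert y) X) ((0 , ms) ∷ removals 0 ms)))
      ≡⟨ length-concat-map (block (vert y) X) ((0 , ms) ∷ removals 0 ms) ⟩
    -- The block of `(0 , ms)` prepends nothing, so it is `vert y X ms` mapped by the identity.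
    length (map (λ q → q) (vert y X ms)) + S
      ≡⟨ cong (_+ S) (length-map (λ q → q) (vert y X ms)) ⟩
    length (vert y X ms) + S ∎
    where
    open ≡-Reasoning
    S = sum (map (length ∘ block (vert y) X) (removals 0 ms))

  ending-count-suc : ∀ y → VertCount y → EndingCount (suc y)
  ending-count-suc y vert-count X ms kX≤1+y =
    subst (λ c → Count K v (suc y) c ms) (sym (length-ending (suc y) X ms kX≤1+y))
      (count (add-block (weight ms) _ _ y k m (K C v) (comps K v) (sum ms) _ (sum≡0⇒total≡0 0 ms)
        (vert-count X ms kX≤1+y .equation)
        (sum-removals γ δ (m ∸_) 1 c 0 ms removal-eq)
        (wsum-complement m 0 ms ≤-refl)))
    where
    K = rows (suc y)
    m = total 0 ms
    v = K ∸ X + m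
    c = length ∘ block (vert (suc y)) X
    -- Neither γ nor δ depends on the removed part a: any removal lowers l by one and keeps K and v.
    -- The part enters only through the sum m - a of the remaining runs.
    γ = falling⁻ y (pred (sum ms)) * (k * (K C v))
    δ = falling (suc y) (pred (sum ms)) * comps K v
    removal-eq : ∀ {a ms′} → (a , ms′) ∈ removals 0 ms → 1 * weight ms′ * c (a , ms′) + γ * (m ∸ a) ≡ δ
    removal-eq {a} {ms′} p = subst
      (λ l → 1 * weight ms′ * c (a , ms′) + falling⁻ y l * (k * (K C v)) * (m ∸ a) ≡ falling (suc y) l * comps K v)
      (sym (cong pred (sum-removal 0 ms p))) (trans
      (cong₂ _+_ (cong (_* c (a , ms′)) (+-identityʳ (weight ms′)))
        (trans (cong (falling⁻ y (sum ms′) * (k * (K C v)) *_) (trans (cong (_∸ a) (total-removal 0 ms p)) (m+n∸m≡n a _)))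
               (assoc (falling⁻ y (sum ms′)) k (K C v) (total 0 ms′))))
      (block-count y vert-count {X} {a} {ms} {ms′} kX≤1+y (total-removal 0 ms p) .equation))
      where
      assoc : ∀ f k b z → f * (k * b) * z ≡ f * (k * (z * b))
      assoc = solve-∀

  ending-count-zero : EndingCount 0
  ending-count-zero (suc X) ms kX≤0 = contradiction (≤-trans (m≤n*m (suc X) k {{>-nonZero 1≤k}}) kX≤0) λ ()
  ending-count-zero zero ms kX≤0 = subst (λ c → Count 0 (total 0 ms) 0 c ms) (sym length-eq) (by-sum (sum ms) refl)
    where
    -- At X = 0 no run of positive length passes the guard of `block`.
    no-blocks : ∀ ps → All ((0 <_) ∘ proj₁) ps → sum (map (length ∘ block (vert 0) 0) ps) ≡ 0
    no-blocks [] [] = refl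
    no-blocks ((suc a , ms) ∷ ps) (_ ∷ pos) = no-blocks ps pos
    length-eq : length (ending 0 0 ms) ≡ length (vert 0 0 ms)
    length-eq = trans (length-ending 0 0 ms kX≤0)
      (trans (cong (length (vert 0 0 ms) +_) (no-blocks (removals 0 ms) (removals-> 0 ms))) (+-identityʳ _))
    empty-start : ∀ {l} → sum ms ≡ suc l → length (vert 0 0 ms) ≡ 0
    empty-start eq = cong length (when-no ((0 ≟ 0) ×-dec (sum ms ≟ 0)) λ (_ , z) → contradiction (trans (sym z) eq) λ ())
    by-sum : ∀ l → sum ms ≡ l → Count 0 (total 0 ms) 0 (length (vert 0 0 ms)) ms
    by-sum zero eq = subst (λ c → Count 0 (total 0 ms) 0 c ms)
      (sym (cong length (when-yes ((0 ≟ 0) ×-dec (sum ms ≟ 0)) {[] ∷ []} (refl , eq)))) (count one)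
      where
      one : weight ms * 1 + falling⁻ 0 (sum ms) * (k * (total 0 ms * (0 C total 0 ms)))
        ≡ falling 1 (sum ms) * comps 0 (total 0 ms)
      one rewrite eq | sum≡0⇒weight≡1 ms eq | sum≡0⇒total≡0 0 ms eq = refl
    by-sum (suc l) eq rewrite empty-start eq =
      -- Here K = 0, while v = m is at least the number of runs, which is positive.
      Count-vanishing ms (<-≤-trans (subst (0 <_) (sym eq) z<s) (sum≤total 0 ms))

  ending-count : ∀ y → EndingCount y
  ending-count zero    = ending-count-zero
  ending-count (suc y) = ending-count-suc y (vert-count y (ending-count y))

  -- Correctness of the enumeration.

  -- Small paths read from their last step, each condition kept at the steps that can violate it.
  -- For a diagonal step from (x , y), k(x+1) ≤ y says that it ends strictly above the line; a north
  -- step preserves (C1) by itself.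
  data Admissible : ℕ → ℕ → List Step → Set where
    start : Admissible 0 0 []
    east  : ∀ {x y q} → k * suc x ≤ y → Admissible x y q → Admissible (suc x) y (E ∷ q)
    north : ∀ {x y q} → Admissible x y q → Admissible x (suc y) (N ∷ q)
    diag  : ∀ {x y q} → k * suc x ≤ y → suc y ≡ k * rows y + r → Admissible x y q →
            Admissible (suc x) (suc y) (D ∷ q)

  above-line : ∀ {x y q} → Admissible x y q → k * x ≤ y
  above-line start        = ≤-reflexive (*-zeroʳ k)
  above-line (east p _)   = p
  above-line (north ok)   = m≤n⇒m≤1+n (above-line ok)
  above-line (diag p _ _) = m≤n⇒m≤1+n p

  -- Along the run y is constant and kx grows, so the bound at its end implies the bound at every
  -- earlier vertex.
  add-east : ∀ a {x y q} → k * (a + x) ≤ y → Admissible x y q → Admissible (a + x) y (replicate a E ++ q)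
  add-east zero    p ok = ok
  add-east (suc a) {x} p ok = east p (add-east a (≤-trans (*-monoʳ-≤ k (n≤1+n (a + x))) p) ok)

  split-east : ∀ {X y q} → Admissible X y q → ∃₂ λ a q′ → ∃ λ x →
    q ≡ replicate a E ++ q′ × X ≡ a + x × Admissible x y q′ × lead q′ ≡ 0
  split-east start = 0 , [] , 0 , refl , refl , start , refl
  split-east (east p ok) with split-east ok
  ... | a , q′ , x , refl , refl , ok′ , lead≡0 = suc a , q′ , x , refl , refl , ok′ , lead≡0
  split-east ok@(north _)    = 0 , _ , _ , refl , refl , ok , refl
  split-east ok@(diag _ _ _) = 0 , _ , _ , refl , refl , ok , refl

  VertSpec EndingSpec : ℕ → Set
  VertSpec y   = ∀ X ms q → q ∈ vert y X ms ⇔ (Admissible X y q × lead q ≡ 0 × runs q ↭ expand 0 ms)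
  EndingSpec y = ∀ X ms q → q ∈ ending y X ms ⇔ (Admissible X y q × runs q ↭ expand 0 ms)

  ∈-block⁻ : ∀ y {X a ms q} → q ∈ block (vert y) X (a , ms) →
    a ≤ X × ∃ λ q′ → q′ ∈ vert y (X ∸ a) ms × q ≡ replicate a E ++ q′
  ∈-block⁻ y {X} {a} q∈ = Product.map₂ (∈-map⁻ (replicate a E ++_)) (∈-when⁻ (a ≤? X) q∈)

  ending-spec : ∀ y → VertSpec y → EndingSpec y
  ending-spec y spec X ms q = mk⇔ sound complete
    where
    sound : q ∈ ending y X ms → Admissible X y q × runs q ↭ expand 0 ms
    sound q∈ with ∈-when⁻ (k * X ≤? y) q∈
    ... | kX≤y , q∈′ with ∈-concat⁻′ (map (block (vert y) X) ((0 , ms) ∷ removals 0 ms)) q∈′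
    ...   | _ , q∈b , b∈ with ∈-map⁻ (block (vert y) X) b∈
    ...     | (a , ms′) , m , refl with ∈-block⁻ y {X} {a} q∈b
    ...       | a≤X , q′ , q′∈ , refl with to (spec (X ∸ a) ms′ q′) q′∈
    ...         | ok , lead≡0 , p =
      subst (λ x → Admissible x y _) (m+[n∸m]≡n a≤X) (add-east a (subst (λ x → k * x ≤ y) (sym (m+[n∸m]≡n a≤X)) kX≤y) ok)
      , block-runs⁺ ms q′ lead≡0 m p
    complete : Admissible X y q × runs q ↭ expand 0 ms → q ∈ ending y X ms
    complete (ok , p) with split-east ok
    ... | a , q′ , x , refl , refl , ok′ , lead≡0 with block-runs⁻ ms a q′ lead≡0 p
    ...   | ms′ , m , p′ = ∈-when⁺ (k * (a + x) ≤? y) (above-line ok)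
      (∈-concat⁺′ (∈-when⁺ (a ≤? a + x) (m≤m+n a x)
          (∈-map⁺ (replicate a E ++_)
            (from (spec (a + x ∸ a) ms′ q′) (subst (λ z → Admissible z y q′) (sym (m+n∸m≡n a x)) ok′ , lead≡0 , p′))))
        (∈-map⁺ (block (vert y) (a + x)) m))

  vert-spec : ∀ y → VertSpec y
  vert-spec zero X ms q = mk⇔ sound complete
    where
    sound : q ∈ vert 0 X ms → Admissible X 0 q × lead q ≡ 0 × runs q ↭ expand 0 ms
    sound q∈ with ∈-when⁻ ((X ≟ 0) ×-dec (sum ms ≟ 0)) q∈
    ... | (refl , sum≡0) , here refl = start , refl , ↭-reflexive (sym (sum≡0⇒expand≡[] 0 ms sum≡0))
    complete : Admissible X 0 q × lead q ≡ 0 × runs q ↭ expand 0 ms → q ∈ vert 0 X ms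
    complete (start , _ , p) = ∈-when⁺ ((0 ≟ 0) ×-dec (sum ms ≟ 0))
      (refl , trans (sym (length-expand 0 ms)) (sym (↭-length p))) (here refl)
  vert-spec (suc y) X ms q = mk⇔ sound complete
    where
    spec : EndingSpec y
    spec = ending-spec y (vert-spec y)
    aligned? : Dec (suc y ≡ k * rows y + r)
    aligned? = suc y ≟ k * rows y + r
    sound-diag : ∀ X → suc y ≡ k * rows y + r → q ∈ diags (ending y) y X ms →
      Admissible X (suc y) q × lead q ≡ 0 × runs q ↭ expand 0 ms
    sound-diag (suc X) al q∈ with ∈-when⁻ (k * suc X ≤? y) q∈
    ... | kX≤y , q∈′ with ∈-map⁻ (D ∷_) q∈′
    ...   | q′ , q′∈ , refl with to (spec X ms q′) q′∈
    ...     | ok , p = diag kX≤y al ok , refl , p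
    sound : q ∈ vert (suc y) X ms → Admissible X (suc y) q × lead q ≡ 0 × runs q ↭ expand 0 ms
    sound q∈ with ∈-++⁻ (map (N ∷_) (ending y X ms)) q∈
    ... | inj₂ q∈D = let al , q∈D′ = ∈-when⁻ aligned? q∈D in sound-diag X al q∈D′
    ... | inj₁ q∈N with ∈-map⁻ (N ∷_) q∈N
    ...   | q′ , q′∈ , refl with to (spec X ms q′) q′∈
    ...     | ok , p = north ok , refl , p
    complete : Admissible X (suc y) q × lead q ≡ 0 × runs q ↭ expand 0 ms → q ∈ vert (suc y) X ms
    complete (north ok , _ , p) = ∈-++⁺ˡ (∈-map⁺ (N ∷_) (from (spec X ms _) (ok , p)))
    complete (diag {x} kX≤y al ok , _ , p) = ∈-++⁺ʳ (map (N ∷_) (ending y X ms))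
      (∈-when⁺ aligned? al (∈-when⁺ (k * suc x ≤? y) kX≤y (∈-map⁺ (D ∷_) (from (spec x ms _) (ok , p)))))

  -- Distinctness of the listed paths.

  -- Blocks for different a share no path, since `lead` reads off the length of the last run.
  lead-block : ∀ y {X a ms q} → q ∈ block (vert y) X (a , ms) → lead q ≡ a
  lead-block y {X} {a} {ms} q∈ with ∈-block⁻ y {X} {a} q∈
  ... | _ , q′ , q′∈ , refl = begin
    lead (replicate a E ++ q′)   ≡⟨ lead-replicate a q′ ⟩
    a + lead q′                  ≡⟨ cong (a +_) (proj₁ (proj₂ (to (vert-spec y (X ∸ a) ms q′) q′∈))) ⟩
    a + 0                        ≡⟨ +-identityʳ a ⟩
    a                            ∎
    where open ≡-Reasoning

  VertUnique EndingUnique : ℕ → Set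
  VertUnique y   = ∀ X ms → Unique (vert y X ms)
  EndingUnique y = ∀ X ms → Unique (ending y X ms)

  ending-unique : ∀ y → VertUnique y → EndingUnique y
  ending-unique y unique X ms = when-unique (k * X ≤? y) (Unique.concat⁺
    (All.map⁺ (All.universal block-unique ((0 , ms) ∷ removals 0 ms)))
    -- The entry for no last run differs from all others because removed parts are positive.
    (AllPairs.map⁺ (AllPairs.map blocks-disjoint (All.map <⇒≢ (removals-> 0 ms) ∷ removals-distinct 0 ms))))
    where
    block-unique : ∀ u → Unique (block (vert y) X u)
    block-unique (a , ms′) = when-unique (a ≤? X) (Unique.map⁺ (++-cancelˡ (replicate a E) _ _) (unique (X ∸ a) ms′))
    blocks-disjoint : ∀ {u v} → proj₁ u ≢ proj₁ v → Disjoint (block (vert y) X u) (block (vert y) X v)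
    blocks-disjoint a≢b (q∈a , q∈b) = a≢b (trans (sym (lead-block y {X} q∈a)) (lead-block y {X} q∈b))

  vert-unique : ∀ y → VertUnique y
  vert-unique zero X ms = when-unique ((X ≟ 0) ×-dec (sum ms ≟ 0)) ([] ∷ [])
  vert-unique (suc y) X ms = Unique.++⁺ (Unique.map⁺ ∷-injectiveʳ (ih X ms))
    (when-unique (suc y ≟ k * rows y + r) (diags-unique X)) disjoint
    where
    ih : EndingUnique y
    ih = ending-unique y (vert-unique y)
    diags-unique : ∀ X → Unique (diags (ending y) y X ms)
    diags-unique zero    = []
    diags-unique (suc X) = when-unique (k * suc X ≤? y) (Unique.map⁺ ∷-injectiveʳ (ih X ms))
    diags-D : ∀ X {q} → q ∈ diags (ending y) y X ms → ∃ λ q′ → q ≡ D ∷ q′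
    diags-D (suc X) q∈ with ∈-map⁻ (D ∷_) (proj₂ (∈-when⁻ (k * suc X ≤? y) q∈))
    ... | q′ , _ , eq = q′ , eq
    disjoint : Disjoint (map (N ∷_) (ending y X ms)) (when (suc y ≟ k * rows y + r) (diags (ending y) y X ms))
    disjoint (q∈N , q∈D) with ∈-map⁻ (N ∷_) q∈N | diags-D X (proj₂ (∈-when⁻ (suc y ≟ k * rows y + r) q∈D))
    ... | _ , _ , refl | _ , ()

  -- Admissible lists and small Fuss-Schröder paths.

  admissible-position : ∀ {x y q} → Admissible x y q → x ≡ xpos q × y ≡ ypos q
  admissible-position start          = refl , refl
  admissible-position (east _ ok)    = Product.map (cong suc) (λ eq → eq) (admissible-position ok)
  admissible-position (north ok)     = Product.map (λ eq → eq) (cong suc) (admissible-position ok)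
  admissible-position (diag _ _ ok)  = Product.map (cong suc) (cong suc) (admissible-position ok)

  admissible-suffix : ∀ u {x y q} → Admissible x y (u ++ q) → Admissible (xpos q) (ypos q) q
  admissible-suffix [] ok with admissible-position ok
  ... | refl , refl = ok
  admissible-suffix (E ∷ u) (east _ ok)   = admissible-suffix u ok
  admissible-suffix (N ∷ u) (north ok)    = admissible-suffix u ok
  admissible-suffix (D ∷ u) (diag _ _ ok) = admissible-suffix u ok

  DiagonalOK : List Step → Set
  DiagonalOK s = k * suc (xpos s) ≤ ypos s × suc (ypos s) ≡ k * rows (ypos s) + r

  -- Suffixes of a reversed path are reversed prefixes of the path, so conditions on all prefixes
  -- become conditions that recurse along q.
  admissible : ∀ q → (∀ u s → q ≡ u ++ s → k * xpos s ≤ ypos s) →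
    (∀ u s → q ≡ u ++ D ∷ s → DiagonalOK s) → Admissible (xpos q) (ypos q) q
  admissible []      above diagonal = start
  admissible (E ∷ q) above diagonal = east (above [] (E ∷ q) refl)
    (admissible q (λ u s eq → above (E ∷ u) s (cong (E ∷_) eq)) (λ u s eq → diagonal (E ∷ u) s (cong (E ∷_) eq)))
  admissible (N ∷ q) above diagonal = north
    (admissible q (λ u s eq → above (N ∷ u) s (cong (N ∷_) eq)) (λ u s eq → diagonal (N ∷ u) s (cong (N ∷_) eq)))
  admissible (D ∷ q) above diagonal = diag (proj₁ (diagonal [] q refl)) (proj₂ (diagonal [] q refl))
    (admissible q (λ u s eq → above (D ∷ u) s (cong (D ∷_) eq)) (λ u s eq → diagonal (D ∷ u) s (cong (D ∷_) eq)))

  small⇒admissible : ∀ {n p} → SmallFS k r n p → Admissible n (k * n) (reverse p)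
  small⇒admissible {n} {p} small = subst₂ (λ x y → Admissible x y (reverse p))
    (trans (xpos-reverse p) endX) (trans (ypos-reverse p) endY) (admissible (reverse p) above diagonal)
    where
    open SmallFS small
    open LargeFS large
    above : ∀ u s → reverse p ≡ u ++ s → k * xpos s ≤ ypos s
    above u s eq = subst₂ (λ x y → k * x ≤ y) (xpos-reverse s) (ypos-reverse s)
      (C1 (reverse s) (reverse u) (trans (reverse-flip eq) (reverse-++ u s)))
    diagonal : ∀ u s → reverse p ≡ u ++ D ∷ s → DiagonalOK s
    diagonal u s eq =
        -- (C1) at the end of the diagonal step gives k(x+1) ≤ y + 1; `noTouch₁` excludes equality.
        s≤s⁻¹ (≤∧≢⇒< (above u (D ∷ s) eq) (λ touch → noTouch₁ (reverse s) (reverse u) split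
          (trans (cong suc (ypos-reverse s)) (trans (sym touch) (cong (λ x → k * suc x) (sym (xpos-reverse s)))))))
      , rows-aligned (trans (cong suc (sym (ypos-reverse s))) (proj₂ (C2 (reverse s) (reverse u) split)))
      where
      split : p ≡ reverse s ++ D ∷ reverse u
      split = trans (reverse-flip eq) (reverse-∷-++ u D s)

  admissible⇒small : ∀ {n p} → Admissible n (k * n) (reverse p) → SmallFS k r n p
  admissible⇒small {n} {p} ok = record
    { large = record
      { endX = trans (sym (xpos-reverse p)) (sym (proj₁ (admissible-position ok)))
      ; endY = trans (sym (ypos-reverse p)) (sym (proj₂ (admissible-position ok)))
      ; C1   = above
      ; C2   = λ s t eq → rows (ypos s) , aligned s t eq
      }
    -- Both follow from k(x+1) ≤ y: the start is strictly above the line because k > 0, the end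
    -- because y < y + 1.
    ; noTouch₀ = λ s t eq touch → <⇒≱ (*-monoʳ-< k {{>-nonZero 1≤k}} (n<1+n (xpos s)))
        (≤-trans (strict s t eq) (≤-reflexive touch))
    ; noTouch₁ = λ s t eq touch → <⇒≱ (n<1+n (ypos s)) (≤-trans (≤-reflexive touch) (strict s t eq))
    }
    where
    above : ∀ s t → p ≡ s ++ t → k * xpos s ≤ ypos s
    above s t refl = subst₂ (λ x y → k * x ≤ y) (xpos-reverse s) (ypos-reverse s)
      (above-line (admissible-suffix (reverse t) (subst (Admissible _ _) (reverse-++ s t) ok)))
    diagonal : ∀ s t → p ≡ s ++ D ∷ t → DiagonalOK (reverse s)
    diagonal s t refl with admissible-suffix (reverse t) {q = D ∷ reverse s} (subst (Admissible _ _) (reverse-∷-++ s D t) ok)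
    ... | diag below al _ = below , al
    strict : ∀ s t → p ≡ s ++ D ∷ t → k * suc (xpos s) ≤ ypos s
    strict s t eq = subst₂ (λ x y → k * suc x ≤ y) (xpos-reverse s) (ypos-reverse s) (proj₁ (diagonal s t eq))
    aligned : ∀ s t → p ≡ s ++ D ∷ t → suc (ypos s) ≡ k * rows (ypos s) + r
    aligned s t eq = subst (λ y → suc y ≡ k * rows y + r) (ypos-reverse s) (proj₂ (diagonal s t eq))

  -- The small paths of length n and their number.

  smallPaths : ℕ → List ℕ → Paths
  smallPaths n ms = map reverse (ending (k * n) n ms)

  smallPaths-unique : ∀ n ms → Unique (smallPaths n ms)
  smallPaths-unique n ms = Unique.map⁺ reverse-injective (ending-unique (k * n) (vert-unique (k * n)) n ms)

  smallPaths-spec : ∀ n ms p → p ∈ smallPaths n ms ⇔ (SmallFS k r n p × runs p ↭ expand 0 ms)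
  smallPaths-spec n ms p = mk⇔ sound complete
    where
    spec : EndingSpec (k * n)
    spec = ending-spec (k * n) (vert-spec (k * n))
    sound : p ∈ smallPaths n ms → SmallFS k r n p × runs p ↭ expand 0 ms
    sound p∈ with ∈-map⁻ reverse p∈
    ... | q , q∈ , eq with to (spec n ms q) q∈
    ...   | ok , perm = admissible⇒small (subst (Admissible n (k * n)) (reverse-flip {q} (sym eq)) ok)
        , ↭-trans (runs-reverse p) (↭-trans (↭-reflexive (cong runs (sym (reverse-flip {q} (sym eq))))) perm)
    complete : SmallFS k r n p × runs p ↭ expand 0 ms → p ∈ smallPaths n ms
    complete (small , perm) = subst (_∈ smallPaths n ms) (reverse-involutive p)
      (∈-map⁺ reverse (from (spec n ms (reverse p)) (small⇒admissible small , ↭-trans (↭-sym (runs-reverse p)) perm)))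

  -- With f = (y)ₗ and b = C(n-1,m-1), the main term is (y+1) f b, and the subtracted one is y f b
  -- because m C(n,m) = n b and y = kn; one f b remains.
  length-smallPaths : ∀ n ms l → sum ms ≡ suc l →
    weight ms * length (smallPaths n ms) ≡ falling (k * n) l * comps n (total 0 ms)
  length-smallPaths n ms l sum≡ = begin
    w * length (map reverse (ending y n ms))   ≡⟨ cong (w *_) (length-map reverse (ending y n ms)) ⟩
    w * c                                      ≡⟨ +-cancelʳ-≡ (f * (k * (n * b))) (w * c) (f * b) padded ⟩
    f * b                                      ∎
    where
    open ≡-Reasoning
    y = k * n
    w = weight ms
    m = total 0 ms
    c = length (ending y n ms)
    f = falling y l
    b = comps n m
    K≡n : rows y ≡ n
    K≡n = rows-on-line refl
    v≡m : rows y ∸ n + m ≡ m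
    v≡m = cong (_+ m) (trans (cong (_∸ n) K≡n) (n∸n≡0 n))
    formula : w * c + falling⁻ y (suc l) * (k * (m * (n C m))) ≡ falling (suc y) (suc l) * b
    formula = subst (λ s → w * c + falling⁻ y s * (k * (m * (n C m))) ≡ falling (suc y) s * b) sum≡
      (Count.equation (subst₂ (λ K v → Count K v y c ms) K≡n v≡m (ending-count y n ms ≤-refl)))
    regroup : ∀ k n f b → suc (k * n) * f * b ≡ f * b + f * (k * (n * b))
    regroup = solve-∀
    padded : w * c + f * (k * (n * b)) ≡ f * b + f * (k * (n * b))
    padded = begin
      w * c + f * (k * (n * b))           ≡⟨ cong (λ t → w * c + f * (k * t)) (comps-absorption n m) ⟨
      w * c + f * (k * (m * (n C m)))     ≡⟨ formula ⟩
      falling (suc y) (suc l) * b         ≡⟨ cong (_* b) (falling-absorption y l) ⟩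
      suc y * f * b                       ≡⟨ regroup k n f b ⟩
      f * b + f * (k * (n * b))           ∎

-- From the parts of λ to their multiplicities.

≤-sum : ∀ as → All (_≤ sum as) as
≤-sum []       = []
≤-sum (a ∷ as) = m≤m+n a (sum as) ∷ All.map (λ p → ≤-trans p (m≤n+m (sum as) a)) (≤-sum as)

weight-mults : ∀ as → All (1 ≤_) as → weight (mults (sum as) as) ≡ mλ as
weight-mults as pos = begin
  product (map _! (applyUpTo (λ i → mult (suc i) as) s))       ≡⟨ cong product (map-applyUpTo (λ i → mult (suc i) as) _! s) ⟩
  product (applyUpTo (λ i → mult (suc i) as !) s)              ≡⟨ cong product (map-applyUpTo suc (λ i → mult i as !) s) ⟨
  product (map (λ i → mult i as !) (applyUpTo suc s))          ≡⟨ *-identityˡ _ ⟨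
  -- The product in `mλ` starts at index 0, whose factor is 0! = 1 since all parts are positive;
  -- `mults` starts at 1.
  1 * product (map (λ i → mult i as !) (applyUpTo suc s))      ≡⟨ cong (λ c → c ! * product (map (λ i → mult i as !) (applyUpTo suc s))) no-zeros ⟨
  mλ as                                                        ∎
  where
  open ≡-Reasoning
  s = sum as
  no-zeros : mult 0 as ≡ 0
  no-zeros = cong length (filter-none (0 ≟_) (All.map <⇒≢ pos))

theorem3p3 : (k n r : ℕ) → 1 ≤ k → 1 ≤ n → 1 ≤ r → r ≤ k →
    (λs : List ℕ) → IsPartition λs → 1 ≤ length λs →
    Σ (List (List Step)) (λ L →
    Unique L
    × (∀ p → (p ∈ L) ⇔ (SmallFS k r n p × runs p ↭ λs))
    × (length L * mλ λs
    ≡ ((n ∸ 1) C (sum λs ∸ 1)) * ((n * k) C (length λs ∸ 1)) * ((length λs ∸ 1) !))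
    × ((n * k + 1) * (length L * mλ λs)
    ≡ ((n ∸ 1) C (sum λs ∸ 1)) * ((n * k + 1) C length λs) * (length λs !)))
theorem3p3 k (suc n) r 1≤k _ 1≤r r≤k λs@(suc a ∷ as) (pos , _) _ =
  smallPaths (suc n) ms , smallPaths-unique (suc n) ms , spec , count₁ , count₂
  where
  open SmallPaths k r 1≤k 1≤r r≤k
  open ≡-Reasoning
  ms = mults (sum λs) λs
  perm : expand 0 ms ↭ λs
  perm = expand-mults (sum λs) λs pos (≤-sum λs)
  spec : ∀ p → p ∈ smallPaths (suc n) ms ⇔ (SmallFS k r (suc n) p × runs p ↭ λs)
  spec p = mk⇔
    (Product.map₂ (λ q → ↭-trans q perm) ∘ to (smallPaths-spec (suc n) ms p))
    (from (smallPaths-spec (suc n) ms p) ∘ Product.map₂ (λ q → ↭-trans q (↭-sym perm)))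
  c = length (smallPaths (suc n) ms)
  l = length as
  -- The path length and the first part being successors here, `comps` reduces to this binomial,
  -- with n the length minus 1.
  b = n C (a + sum as)
  y = suc n * k
  total≡ : total 0 ms ≡ sum λs
  total≡ = trans (sym (sum-expand 0 ms)) (sum-↭ perm)
  count₀ : c * mλ λs ≡ falling y l * b
  count₀ = begin
    c * mλ λs                                          ≡⟨ *-comm c (mλ λs) ⟩
    mλ λs * c                                          ≡⟨ cong (_* c) (weight-mults λs pos) ⟨
    weight ms * c                                      ≡⟨ length-smallPaths (suc n) ms l (trans (sym (length-expand 0 ms)) (↭-length perm)) ⟩
    falling (k * suc n) l * comps (suc n) (total 0 ms) ≡⟨ cong₂ (λ z t → falling z l * comps (suc n) t) (*-comm k (suc n)) total≡ ⟩
    falling y l * b                                    ∎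
  count₁ : c * mλ λs ≡ b * (y C l) * l !
  count₁ = trans count₀ (rotate (y C l) (l !) b)
    where
    rotate : ∀ x f b → x * f * b ≡ b * x * f
    rotate = solve-∀
  count₂ : (y + 1) * (c * mλ λs) ≡ b * ((y + 1) C suc l) * suc l !
  count₂ = begin
    (y + 1) * (c * mλ λs)                  ≡⟨ cong₂ _*_ (+-comm y 1) count₀ ⟩
    -- The factor y + 1 is absorbed by (y)ₗ, giving (y+1)ₗ₊₁.
    suc y * (falling y l * b)              ≡⟨ *-assoc (suc y) (falling y l) b ⟨
    suc y * falling y l * b                ≡⟨ cong (_* b) (falling-absorption y l) ⟨
    falling (suc y) (suc l) * b            ≡⟨ *-comm _ b ⟩
    b * ((suc y C suc l) * suc l !)        ≡⟨ *-assoc b (suc y C suc l) (suc l !) ⟨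
    b * (suc y C suc l) * suc l !          ≡⟨ cong (λ z → b * (z C suc l) * suc l !) (+-comm y 1) ⟨
    b * ((y + 1) C suc l) * suc l !        ∎
theorem3p3 k (suc n) r _ _ _ _ (zero ∷ as) (() ∷ _ , _) _
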